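{- Let $n\ge 3$ be an integer and let $K=\{132,312\}\{321,213\}$. The number of equivalence classes of $S_n$ under $K$-equivalence is $\dfrac{n(n+1)}{2}-2$.
   Context: Permutations in $S_n$ are written as words $\pi_1\pi_2\cdots\pi_n$ in one-line notation. The order permutation of a word $u$ of $c$ distinct positive integers is the unique $\sigma\in S_c$ with $\sigma_i<\sigma_j$ iff $u_i<u_j$. A replacement partition $K$ of $S_c$ is a set partition of $S_c$; it is denoted by listing its parts with the one-element parts (and outer brackets) omitted, so here $K$ is the set partition of $S_3$ whose only parts of size greater than one are $\{132,312\}$ and $\{321,213\}$. The $K$-equivalence on $S_n$ is the equivalence relation generated by: $\phi\equiv\psi$ whenever $\phi=aub$ and $\psi=avb$ (concatenations) for some possibly empty words $a,b$ and words $u,v$ of length $c$ (so $u,v$ occupy the same $c$ consecutive positions) such that the order permutations of $u$ and $v$ lie in the same part of $K$. All equivalence classes are counted, including one-element classes. -}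

module Defs where

open import Data.Nat using (ℕ; _≤_; _<_; _≟_; _≤?_)
open import Data.Fin using (Fin)
open import Data.List using (List; []; _∷_; _++_)
open import Data.List.Membership.Propositional using (_∈_)
open import Data.List.Relation.Unary.Any using (Any)
open import Data.List.Relation.Unary.AllPairs using (AllPairs)
open import Data.List.Relation.Binary.Disjoint.Propositional using (Disjoint)
open import Data.Product using (_×_; _,_; ∃-syntax)
open import Data.Sum using (_⊎_)
open import Data.Vec using (Vec; lookup; toList; []; _∷_)
import Data.Vec.Relation.Unary.All as VecAll
import Data.Vec.Relation.Unary.AllPairs as VecAllPairs
open import Data.Vec.Relation.Unary.Unique.Propositional using (Unique)
open import Function.Bundles using (_⇔_)
open import Relation.Binary.Bundles using (Setoid)
open import Relation.Binary.Construct.Closure.Equivalence using (EqClosure; setoid)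
open import Relation.Binary.PropositionalEquality using (_≡_; refl)
open import Relation.Nullary using (Dec)
open import Relation.Nullary.Decidable using (True; toWitness; _×-dec_; ¬?)
open import Level using (0ℓ)

-- One-line notation uses the letters 1, …, n, not 0, …, n - 1.
IsPermutation : ∀ {n} → Vec ℕ n → Set
IsPermutation {n} w = VecAll.All (λ x → 1 ≤ x × x ≤ n) w × Unique w

isPermutation? : ∀ {n} (w : Vec ℕ n) → Dec (IsPermutation w)
isPermutation? {n} w =
  VecAll.all? (λ x → (1 ≤? x) ×-dec (x ≤? n)) w
  ×-dec VecAllPairs.allPairs? (λ x y → ¬? (x ≟ y)) w

-- The proof field is irrelevant, so that elements of S n with the same word
-- are equal; it can be recovered by recomputing from isPermutation?.
record S (n : ℕ) : Set where
  constructor perm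
  field
    word           : Vec ℕ n
    .isPermutation : IsPermutation word

open S public

⟪_⟫ : ∀ {n} (w : Vec ℕ n) {_ : True (isPermutation? w)} → S n
⟪ w ⟫ {p} = perm w (toWitness p)

IsOrderPermutationOf : ∀ {c} → S c → Vec ℕ c → Set
IsOrderPermutationOf {c} σ u =
  (i j : Fin c) → lookup (word σ) i < lookup (word σ) j ⇔ lookup u i < lookup u j

-- A set partition of S c, given by its parts with one-element parts omitted:
-- every permutation not listed forms a part on its own.
record ReplacementPartition (c : ℕ) : Set where
  field
    parts    : List (List (S c))
    disjoint : AllPairs Disjoint parts

open ReplacementPartition public

SamePart : ∀ {c} → ReplacementPartition c → S c → S c → Set
SamePart K σ τ = σ ≡ τ ⊎ Any (λ part → σ ∈ part × τ ∈ part) (parts K)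

Replacement : ∀ {c} → ReplacementPartition c → ∀ {n} → S n → S n → Set
Replacement {c} K φ ψ =
  ∃[ a ] ∃[ b ] ∃[ u ] ∃[ v ]
    toList (word φ) ≡ a ++ toList {n = c} u ++ b ×
    toList (word ψ) ≡ a ++ toList {n = c} v ++ b ×
    (∃[ σ ] ∃[ τ ] IsOrderPermutationOf σ u × IsOrderPermutationOf τ v × SamePart K σ τ)

KEquivalence : ∀ {c} → ReplacementPartition c → (n : ℕ) → Setoid 0ℓ 0ℓ
KEquivalence K n = setoid {A = S n} (Replacement K)

K₁₃₂₋₃₁₂∣₃₂₁₋₂₁₃ : ReplacementPartition 3
K₁₃₂₋₃₁₂∣₃₂₁₋₂₁₃ = record
  { parts    = (⟪ 1 ∷ 3 ∷ 2 ∷ [] ⟫ ∷ ⟪ 3 ∷ 1 ∷ 2 ∷ [] ⟫ ∷ [])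
             ∷ (⟪ 3 ∷ 2 ∷ 1 ∷ [] ⟫ ∷ ⟪ 2 ∷ 1 ∷ 3 ∷ [] ⟫ ∷ [])
             ∷ []
  ; disjoint = (disj ∷ []) ∷ [] ∷ []
  }
  where
  open import Data.List.Relation.Unary.All using ([]; _∷_)
  open import Data.List.Relation.Unary.AllPairs using ([]; _∷_)
  open import Data.List.Relation.Unary.Any using (here; there)

  disj : Disjoint (⟪ 1 ∷ 3 ∷ 2 ∷ [] ⟫ ∷ ⟪ 3 ∷ 1 ∷ 2 ∷ [] ⟫ ∷ [])
                  (⟪ 3 ∷ 2 ∷ 1 ∷ [] ⟫ ∷ ⟪ 2 ∷ 1 ∷ 3 ∷ [] ⟫ ∷ [])
  disj (here refl         , here ())
  disj (here refl         , there (here ()))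
  disj (there (here refl) , here ())
  disj (there (here refl) , there (here ()))

{-# OPTIONS --safe #-}
module Submission where

-- Idea of the proof.
--
-- Write x ≤ y ≤ z for the letters of a window. The two parts of K give the moves
-- x z y ↔ z x y and z y x ↔ y x z on three consecutive letters. Deleting the
-- largest letter from both sides of a move leaves either a move or two equal words,
-- so deletion of the letters n, n - 1, … is well defined on classes. Hence a class of
-- permutations of 1 … n gives a class for each initial set of letters 1 … m, and the
-- first question is which permutations w of 1 … n can be brought to the form n w′,
-- with w′ a permutation of 1 … n - 1.
--
-- The answer (hasShape): every word with largest letter M is equivalent to
--   * a word that starts with M, or
--   * a weakly increasing word, or
--   * an increasing run up to M followed by one letter z that is at most the letter
--     before M ("dip"), or
--   * b a s with a ≤ b below s, s increasing of length at least two ("pair").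
-- The proof is by induction on the word, adding a letter x in front. Call a word good
-- if it is equivalent to some M w′ with w′ of length at least three. If w is good,
-- then so is x w (Good-∷): whatever the relative order of x and the first three letters
-- of w′, the letter M can be carried over x. It remains to add x in front of the three
-- other shapes; the result is again one of them, or good
-- (good-before-run, good-before-ended-run, good-inside-pair, good-after-pair).
--
-- For permutations of 1 … n the last three shapes are single words: the identity, the
-- words in which one k ≤ n - 2 is moved to the end of the identity, and, for n ≥ 4,
-- 2 1 3 … n (for n = 3 that word is equivalent to 3 2 1). Recursion on n in the first
-- case therefore gives a representative of every class, indexed by the type Code n
-- (classify).
--
-- Different representatives are inequivalent (rep-injective). No move applies to the
-- identity or to a dip word (Rigid), so these are alone in their classes. The words
-- in which 2 1 is inserted in 3 … n are closed under moves (pair-class) and for n ≥ 4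
-- none of them is n followed by a representative. Two representatives that start
-- with n are compared by deleting n (∷-cancel-≈).
--
-- Finally Code 3 has 4 elements and Code n, for n ≥ 4, has n more than Code (n - 1):
-- the identity, the n - 2 dip words and the pair word.

open import Data.Nat using (ℕ; _+_; _*_; _∸_; _≤_)
open import Data.Nat.DivMod using (_/_)
open import Data.Fin using (Fin)
open import Function.Bundles using (Bijection)
open import Relation.Binary.PropositionalEquality using (setoid)
open import Defs

open import Data.Nat using (zero; suc; _<_; _≮_; z≤n; s≤s; s≤s⁻¹; _≟_; _<?_)
open import Data.Nat.Properties
open import Data.Nat.DivMod using (m*n/n≡m)
open import Data.Nat.Tactic.RingSolver using (solve-∀)
open import Data.Fin using (zero; suc; toℕ)
open import Data.Fin.Patterns using (0F; 1F; 2F; 3F)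
open import Data.Fin.Properties using (+↔⊎)
open import Data.List using (List; []; _∷_; _++_; [_]; length; filter)
open import Data.List.Properties using (∷-injectiveʳ; filter-accept; filter-reject; filter-all)
open import Data.List.Membership.Propositional using (_∈_)
open import Data.List.Membership.Propositional.Properties using (∈-∃++)
open import Data.List.Relation.Binary.Equality.Propositional using (≋⇒≡)
open import Data.List.Relation.Binary.Permutation.Propositional as ↭
  using (_↭_; ↭-refl; ↭-sym; ↭-trans; prep; ↭⇒↭ₛ)
open import Data.List.Relation.Binary.Permutation.Propositional.Properties
  using (All-resp-↭; ∈-resp-↭; ↭-length; ↭-empty-inv; drop-∷; shift; ++-comm)
import Data.List.Relation.Binary.Permutation.Setoid.Properties as PermSetoid
open import Data.List.Relation.Binary.Subset.Propositional using (_⊆_)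
open import Data.List.Relation.Unary.All as All using (All; []; _∷_)
open import Data.List.Relation.Unary.AllPairs using ([]; _∷_)
open import Data.List.Relation.Unary.Any using (here; there)
open import Data.List.Relation.Unary.Linked using (Linked; []; [-]; _∷_)
open import Data.List.Relation.Unary.Sorted.TotalOrder.Properties using (↗↭↗⇒≋)
open import Data.List.Relation.Unary.Unique.Propositional using (Unique)
open import Data.Product using (_×_; _,_; ∃-syntax; Σ-syntax; proj₁; proj₂)
open import Data.Sum using (_⊎_; inj₁; inj₂)
open import Data.Sum.Function.Propositional using (_⊎-↔_)
open import Data.Vec as Vec using (Vec; []; _∷_; lookup; toList; fromList; cast)
open import Data.Vec.Properties
  using (toList∘fromList; toList-cast; length-toList; lookup-map; toList-injective; cast-is-id)
import Data.Vec.Relation.Unary.All.Properties as VecAll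
open import Data.Vec.Relation.Unary.AllPairs using ([]; _∷_)
open import Data.Vec.Relation.Unary.Unique.Propositional as VecUnique using ()
open import Function.Base using (_∘_)
open import Function.Bundles using (_⇔_; mk⇔; _↔_; mk↔ₛ′; Equivalence)
open import Function.Construct.Composition using (_↔-∘_; bijection)
open import Function.Construct.Identity using (↔-id)
open import Function.Construct.Symmetry using (↔-sym)
open import Function.Properties.Inverse using (Inverse⇒Bijection)
open import Relation.Binary.Bundles using (Setoid)
import Relation.Binary.Construct.Closure.Equivalence as EqClosure
open EqClosure using (gmap; gfold; return)
open import Relation.Binary.Construct.Closure.ReflexiveTransitive using (ε; _◅_)
open import Relation.Binary.Construct.Closure.Symmetric using (fwd; bwd)
open import Relation.Binary.PropositionalEquality
  using (_≡_; _≢_; ≢-sym; refl; sym; trans; cong; cong₂; subst; subst₂)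
import Relation.Binary.Reasoning.Setoid as SetoidReasoning
open import Relation.Nullary using (¬_; yes; no; contradiction)
open import Relation.Nullary.Decidable using (True; recompute)

private variable
  a b e k m n M t u x y z : ℕ
  es s v w : List ℕ

-- Moves on words of natural numbers

-- The moves: swap is 132 ↔ 312 and turn is 321 ↔ 213, in each case read from left to
-- right. The inequalities are weak so that letters can be compared by totality of ≤ alone;
-- on words with distinct letters they are automatically strict.
data Step : List ℕ → List ℕ → Set where
  swap : x ≤ y → y ≤ z → Step (x ∷ z ∷ y ∷ w) (z ∷ x ∷ y ∷ w)
  turn : x ≤ y → y ≤ z → Step (z ∷ y ∷ x ∷ w) (y ∷ x ∷ z ∷ w)
  skip : Step v w → Step (t ∷ v) (t ∷ w)

-- Words up to the equivalence relation generated by the moves.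
words : Setoid _ _
words = EqClosure.setoid Step

open Setoid words using (_≈_; reflexive) renaming (refl to ≈-refl; sym to ≈-sym; trans to ≈-trans)
open SetoidReasoning words

swap≈ : x ≤ y → y ≤ z → x ∷ z ∷ y ∷ w ≈ z ∷ x ∷ y ∷ w
swap≈ p q = return (swap p q)

turn≈ : x ≤ y → y ≤ z → z ∷ y ∷ x ∷ w ≈ y ∷ x ∷ z ∷ w
turn≈ p q = return (turn p q)

infixr 5 _◂_
_◂_ : ∀ t → v ≈ w → t ∷ v ≈ t ∷ w
t ◂ p = gmap (t ∷_) skip p

step-↭ : Step v w → v ↭ w
step-↭ (swap {x} {y} {z} _ _) = ↭.swap x z ↭-refl
step-↭ (turn {x} {y} {z} _ _) = ↭-trans (↭.swap z y ↭-refl) (prep y (↭.swap z x ↭-refl))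
step-↭ (skip p) = prep _ (step-↭ p)

≈⇒↭ : v ≈ w → v ↭ w
≈⇒↭ = gfold ↭.↭-isEquivalence (λ v → v) step-↭

-- Carrying the largest letter to the front

-- A word is good if it is equivalent to M followed by at least three letters, all at
-- most M.
record Good (M : ℕ) (w : List ℕ) : Set where
  constructor good
  field
    {rest}  : List ℕ
    bounded : All (_≤ M) rest
    long    : 3 ≤ length rest
    toFront : w ≈ M ∷ rest

Good-resp : v ≈ w → Good M w → Good M v
Good-resp p (good bd l q) = good bd l (≈-trans p q)

-- The letter M can always be carried over x. The delicate case is x ≥ y ≥ z ≥ t, where
-- M first moves over y z, then y z t is turned so that M can change the parity of its
-- position.
Good-∷ : x ≤ M → Good M w → Good M (x ∷ w)
Good-∷ _ (good {[]} _ () _)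
Good-∷ _ (good {_ ∷ []} _ (s≤s ()) _)
Good-∷ _ (good {_ ∷ _ ∷ []} _ (s≤s (s≤s ())) _)
Good-∷ {x} {M} x≤M (good {y ∷ z ∷ t ∷ r} bd@(y≤M ∷ z≤M ∷ t≤M ∷ _) l q) =
  good (x≤M ∷ bd) (m≤n⇒m≤1+n l) (≈-trans (x ◂ q) front)
  where
  front : x ∷ M ∷ y ∷ z ∷ t ∷ r ≈ M ∷ x ∷ y ∷ z ∷ t ∷ r
  front with ≤-total x y | ≤-total y z | ≤-total z t
  ... | inj₁ x≤y | _ | _ = swap≈ x≤y y≤M
  ... | inj₂ y≤x | inj₁ y≤z | _ = begin
    x ∷ M ∷ y ∷ z ∷ t ∷ r ≈⟨ x ◂ swap≈ y≤z z≤M ⟨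
    x ∷ y ∷ M ∷ z ∷ t ∷ r ≈⟨ turn≈ y≤x x≤M ⟨
    M ∷ x ∷ y ∷ z ∷ t ∷ r ∎
  ... | inj₂ y≤x | inj₂ z≤y | inj₁ z≤t = begin
    x ∷ M ∷ y ∷ z ∷ t ∷ r ≈⟨ x ◂ turn≈ z≤y y≤M ⟩
    x ∷ y ∷ z ∷ M ∷ t ∷ r ≈⟨ x ◂ y ◂ swap≈ z≤t t≤M ⟩
    x ∷ y ∷ M ∷ z ∷ t ∷ r ≈⟨ turn≈ y≤x x≤M ⟨
    M ∷ x ∷ y ∷ z ∷ t ∷ r ∎
  ... | inj₂ y≤x | inj₂ z≤y | inj₂ t≤z = begin
    x ∷ M ∷ y ∷ z ∷ t ∷ r ≈⟨ x ◂ M ◂ turn≈ t≤z z≤y ⟩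
    x ∷ M ∷ z ∷ t ∷ y ∷ r ≈⟨ x ◂ turn≈ t≤z z≤M ⟩
    x ∷ z ∷ t ∷ M ∷ y ∷ r ≈⟨ x ◂ z ◂ swap≈ (≤-trans t≤z z≤y) y≤M ⟩
    x ∷ z ∷ M ∷ t ∷ y ∷ r ≈⟨ turn≈ (≤-trans z≤y y≤x) x≤M ⟨
    M ∷ x ∷ z ∷ t ∷ y ∷ r ≈⟨ M ◂ x ◂ turn≈ t≤z z≤y ⟨
    M ∷ x ∷ y ∷ z ∷ t ∷ r ∎

-- Run M es u s says that u s is a weakly increasing sequence of letters u, …, M followed
-- by es; at least one letter precedes M.
data Run (M : ℕ) (es : List ℕ) : ℕ → List ℕ → Set where
  end  : u ≤ M → Run M es u (M ∷ es)
  step : u ≤ t → Run M es t s → Run M es u (t ∷ s)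

lower : u ≤ t → Run M es t s → Run M es u s
lower u≤t (end t≤M)    = end (≤-trans u≤t t≤M)
lower u≤t (step t≤y r) = step (≤-trans u≤t t≤y) r

Run-≤ : Run M es u s → u ≤ M
Run-≤ (end u≤M)    = u≤M
Run-≤ (step u≤t r) = ≤-trans u≤t (Run-≤ r)

3≤3+ : ∀ {n} → 3 ≤ 3 + n
3≤3+ = s≤s (s≤s (s≤s z≤n))

-- The word x u … M e …, with u ≤ x, is good. As in the next lemma, x is exchanged with
-- the following letters of the run so that a shorter word of the same kind remains behind a
-- single letter.
good-before-ended-run : Run M (e ∷ es) u s → All (_≤ M) (e ∷ es) → u ≤ x → x ≤ M → Good M (x ∷ u ∷ s)
good-before-ended-run (end u≤M) bd u≤x x≤M =
  good (x≤M ∷ u≤M ∷ bd) 3≤3+ (≈-sym (turn≈ u≤x x≤M))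
good-before-ended-run {u = u} {s = t ∷ s} {x = x} (step u≤t r) bd u≤x x≤M with ≤-total t x
... | inj₁ t≤x = Good-resp (≈-sym (swap≈ u≤t t≤x))
                   (Good-∷ (≤-trans u≤x x≤M) (good-before-ended-run r bd t≤x x≤M))
... | inj₂ x≤t = Good-resp (≈-sym (turn≈ u≤x x≤t))
                   (Good-∷ (Run-≤ r) (good-before-ended-run (lower u≤t r) bd u≤x x≤M))

-- The word x u t … M, with u ≤ t ≤ x, is good. If x lies below u ≤ t or between them,
-- the word need not be good: it is increasing or has the shape pair.
good-before-run : Run M [] t s → u ≤ t → t ≤ x → x ≤ M → Good M (x ∷ u ∷ t ∷ s)
good-before-run {M} {t} {u = u} {x = x} (end t≤M) u≤t t≤x x≤M =
  good (≤-trans u≤t t≤M ∷ x≤M ∷ t≤M ∷ []) 3≤3+ (begin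
    x ∷ u ∷ t ∷ M ∷ [] ≈⟨ swap≈ u≤t t≤x ⟨
    u ∷ x ∷ t ∷ M ∷ [] ≈⟨ u ◂ turn≈ t≤x x≤M ⟨
    u ∷ M ∷ x ∷ t ∷ [] ≈⟨ swap≈ (≤-trans u≤t t≤x) x≤M ⟩
    M ∷ u ∷ x ∷ t ∷ [] ∎)
good-before-run {M} {t} {s = y ∷ s} {u = u} {x = x} (step t≤y r) u≤t t≤x x≤M with ≤-total y x
... | inj₁ y≤x = Good-resp (≈-sym (swap≈ u≤t t≤x))
                   (Good-∷ (≤-trans u≤t (≤-trans t≤x x≤M)) (good-before-run r t≤y y≤x x≤M))
... | inj₂ x≤y = Good-resp (begin
    x ∷ u ∷ t ∷ y ∷ s ≈⟨ swap≈ u≤t t≤x ⟨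
    u ∷ x ∷ t ∷ y ∷ s ≈⟨ u ◂ turn≈ t≤x x≤y ⟨
    u ∷ y ∷ x ∷ t ∷ s ≈⟨ swap≈ (≤-trans u≤t t≤x) x≤y ⟩
    y ∷ u ∷ x ∷ t ∷ s ≈⟨ y ◂ swap≈ u≤t t≤x ⟩
    y ∷ x ∷ u ∷ t ∷ s ∎)
    (Good-∷ (Run-≤ r) (good-before-run (lower t≤y r) u≤t t≤x x≤M))

-- The word x b a s, with a ≤ x ≤ b and b s an increasing run up to M, is good.
good-inside-pair : Run M [] b s → a ≤ x → x ≤ b → Good M (x ∷ b ∷ a ∷ s)
good-inside-pair {M} {b} {a = a} {x = x} (end b≤M) a≤x x≤b =
  good (x≤M ∷ b≤M ∷ ≤-trans a≤x x≤M ∷ []) 3≤3+ (begin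
    x ∷ b ∷ a ∷ M ∷ [] ≈⟨ x ◂ turn≈ (≤-trans a≤x x≤b) b≤M ⟨
    x ∷ M ∷ b ∷ a ∷ [] ≈⟨ swap≈ x≤b b≤M ⟩
    M ∷ x ∷ b ∷ a ∷ [] ∎)
  where
  x≤M : x ≤ M
  x≤M = ≤-trans x≤b b≤M
good-inside-pair {M} {b} {s = t ∷ s} {a = a} {x = x} (step b≤t r) a≤x x≤b =
  Good-resp (begin
    x ∷ b ∷ a ∷ t ∷ s ≈⟨ x ◂ turn≈ (≤-trans a≤x x≤b) b≤t ⟨
    x ∷ t ∷ b ∷ a ∷ s ≈⟨ swap≈ x≤b b≤t ⟩
    t ∷ x ∷ b ∷ a ∷ s ∎)
    (Good-∷ (Run-≤ r) (good-inside-pair (lower b≤t r) a≤x x≤b))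

-- The word b a x u … M, with a ≤ b ≤ u ≤ x, is good.
good-after-pair : Run M [] u s → a ≤ b → b ≤ u → u ≤ x → x ≤ M → Good M (b ∷ a ∷ x ∷ u ∷ s)
good-after-pair {M} {u} {a = a} {b = b} {x = x} (end u≤M) a≤b b≤u u≤x x≤M =
  good (b≤M ∷ ≤-trans a≤b b≤M ∷ x≤M ∷ u≤M ∷ []) 3≤3+ (begin
    b ∷ a ∷ x ∷ u ∷ M ∷ [] ≈⟨ b ◂ a ◂ turn≈ u≤x x≤M ⟨
    b ∷ a ∷ M ∷ x ∷ u ∷ [] ≈⟨ turn≈ a≤b b≤M ⟨
    M ∷ b ∷ a ∷ x ∷ u ∷ [] ∎)
  where
  b≤M : b ≤ M
  b≤M = ≤-trans b≤u u≤M
good-after-pair {M} {u} {s = t ∷ s} {a = a} {b = b} {x = x} (step u≤t r) a≤b b≤u u≤x x≤M with ≤-total t x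
... | inj₁ t≤x = Good-∷ b≤M (Good-∷ (≤-trans a≤b b≤M) (good-before-run r u≤t t≤x x≤M))
  where
  b≤M : b ≤ M
  b≤M = ≤-trans b≤u (≤-trans u≤x x≤M)
... | inj₂ x≤t = Good-resp (begin
    b ∷ a ∷ x ∷ u ∷ t ∷ s ≈⟨ b ◂ a ◂ turn≈ u≤x x≤t ⟨
    b ∷ a ∷ t ∷ x ∷ u ∷ s ≈⟨ turn≈ a≤b (≤-trans b≤u u≤t) ⟨
    t ∷ b ∷ a ∷ x ∷ u ∷ s ∎)
    (Good-∷ (Run-≤ r) (good-after-pair (lower u≤t r) a≤b b≤u u≤x x≤M))

-- Shapes of words up to equivalence

-- Dip M z u s says that u s is a weakly increasing sequence of letters u, …, M followed by
-- the single letter z, and that z is at most the letter before M.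
data Dip (M z : ℕ) : ℕ → List ℕ → Set where
  end  : z ≤ u → u ≤ M → Dip M z u (M ∷ z ∷ [])
  step : u ≤ t → Dip M z t s → Dip M z u (t ∷ s)

Dip⇒Run : Dip M z u s → Run M (z ∷ []) u s
Dip⇒Run (end _ u≤M)  = end u≤M
Dip⇒Run (step u≤t d) = step u≤t (Dip⇒Run d)

-- The normal shapes of a word with largest letter M. In the shape pair the run after b a has
-- at least two letters.
data Shape (M : ℕ) : List ℕ → Set where
  top  : Shape M (M ∷ w)
  inc  : Run M [] u s → Shape M (u ∷ s)
  dip  : Dip M z u s → Shape M (u ∷ s)
  pair : a ≤ b → b ≤ t → Run M [] t s → Shape M (b ∷ a ∷ t ∷ s)

-- The word w is equivalent to a word in normal shape.
HasShape : ℕ → List ℕ → Set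
HasShape M w = ∃[ v ] w ≈ v × Shape M v

Good⇒HasShape : Good M w → HasShape M w
Good⇒HasShape (good _ _ q) = _ , q , top

Dip-bottom : Dip M z u s → All (_≤ M) (u ∷ s) → z ≤ M
Dip-bottom (end z≤u u≤M) _ = ≤-trans z≤u u≤M
Dip-bottom (step _ d) (_ ∷ bd) = Dip-bottom d bd

-- Adding a letter x in front of a word in normal shape. For a word that starts with M, the
-- lengths below four need a separate comparison of letters, since goodness is of no use there.
shape-∷ : All (_≤ M) (x ∷ v) → Shape M v → HasShape M (x ∷ v)
shape-∷ (x≤M ∷ _) (top {w = []}) = _ , ≈-refl , inc (end x≤M)
shape-∷ {M} {x} (x≤M ∷ _ ∷ y≤M ∷ []) (top {w = y ∷ []}) with ≤-total x y
... | inj₁ x≤y = _ , swap≈ x≤y y≤M , top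
... | inj₂ y≤x = _ , ≈-refl , dip (end y≤x x≤M)
shape-∷ {M} {x} (x≤M ∷ _ ∷ y≤M ∷ z≤M ∷ []) (top {w = y ∷ z ∷ []}) with ≤-total x y | ≤-total y z
... | inj₁ x≤y | _ = _ , swap≈ x≤y y≤M , top
... | inj₂ y≤x | inj₁ y≤z = _ , (begin
    x ∷ M ∷ y ∷ z ∷ [] ≈⟨ x ◂ swap≈ y≤z z≤M ⟨
    x ∷ y ∷ M ∷ z ∷ [] ≈⟨ turn≈ y≤x x≤M ⟨
    M ∷ x ∷ y ∷ z ∷ [] ∎) , top
... | inj₂ y≤x | inj₂ z≤y = _ , (begin
    x ∷ M ∷ y ∷ z ∷ [] ≈⟨ x ◂ turn≈ z≤y y≤M ⟩
    x ∷ y ∷ z ∷ M ∷ [] ≈⟨ turn≈ z≤y y≤x ⟩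
    y ∷ z ∷ x ∷ M ∷ [] ∎) , pair z≤y y≤x (end x≤M)
shape-∷ (x≤M ∷ _ ∷ bd) (top {w = y ∷ z ∷ t ∷ r}) =
  Good⇒HasShape (Good-∷ x≤M (good bd 3≤3+ ≈-refl))
shape-∷ {x = x} _ (inc {u} r) with ≤-total x u
shape-∷ _ (inc r) | inj₁ x≤u = _ , ≈-refl , inc (step x≤u r)
shape-∷ (x≤M ∷ _) (inc (end u≤M)) | inj₂ u≤x = _ , ≈-sym (turn≈ u≤x x≤M) , top
shape-∷ {x = x} (x≤M ∷ _) (inc (step {t = t} u≤t r)) | inj₂ u≤x with ≤-total t x
... | inj₁ t≤x = Good⇒HasShape (good-before-run r u≤t t≤x x≤M)
... | inj₂ x≤t = _ , ≈-refl , pair u≤x x≤t r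
shape-∷ {x = x} (x≤M ∷ bd) (dip {u = u} d) with ≤-total x u
... | inj₁ x≤u = _ , ≈-refl , dip (step x≤u d)
... | inj₂ u≤x = Good⇒HasShape (good-before-ended-run (Dip⇒Run d) (Dip-bottom d bd ∷ []) u≤x x≤M)
shape-∷ {x = x} (x≤M ∷ b≤M ∷ _) (pair {a} {b} {t} a≤b b≤t r) with ≤-total x a | ≤-total x b | ≤-total x t
... | inj₁ x≤a | _ | _ = Good⇒HasShape (Good-resp (swap≈ x≤a a≤b)
                           (good-before-run (step (≤-trans a≤b b≤t) r) x≤a a≤b b≤M))
... | inj₂ a≤x | inj₁ x≤b | _ = Good⇒HasShape (good-inside-pair (step b≤t r) a≤x x≤b)
... | inj₂ a≤x | inj₂ b≤x | inj₁ x≤t = _ , turn≈ a≤b b≤x , pair a≤b b≤x (step x≤t r)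
... | inj₂ a≤x | inj₂ b≤x | inj₂ t≤x = Good⇒HasShape (Good-resp (turn≈ a≤b b≤x)
                                         (good-after-pair r a≤b b≤t t≤x x≤M))

-- The induction runs over the letters of w before M; the rest of the word may
-- be replaced by any equivalent word, since moves inside the rest are moves of w.
hasShape : M ∈ w → All (_≤ M) w → HasShape M w
hasShape (here refl) _ = _ , ≈-refl , top
hasShape {w = x ∷ w} (there M∈w) (x≤M ∷ bd)
  with v , w≈v , sh ← hasShape M∈w bd
  with v′ , xv≈v′ , sh′ ← shape-∷ (x≤M ∷ All-resp-↭ (≈⇒↭ w≈v) bd) sh
  = v′ , ≈-trans (x ◂ w≈v) xv≈v′ , sh′

-- Intervals of natural numbers

-- from a k is the word a, a + 1, …, a + k - 1.
from : ℕ → ℕ → List ℕ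
from a zero    = []
from a (suc k) = a ∷ from (suc a) k

from-≥ : ∀ a k → All (a ≤_) (from a k)
from-≥ a zero    = []
from-≥ a (suc k) = ≤-refl ∷ All.map <⇒≤ (from-≥ (suc a) k)

from-< : ∀ a k → All (_< a + k) (from a k)
from-< a zero    = []
from-< a (suc k) rewrite +-suc a k = s≤s (m≤m+n a k) ∷ from-< (suc a) k

-- The largest letter of an interval can be taken out first.
from-last : ∀ a k → from a (suc k) ↭ (a + k) ∷ from a k
from-last a zero    rewrite +-identityʳ a = ↭-refl
from-last a (suc k) rewrite +-suc a k =
  ↭-trans (prep a (from-last (suc a) k)) (↭.swap a _ ↭-refl)

from-linked : ∀ a k → Linked _≤_ (from a k)
from-linked a zero          = []
from-linked a (suc zero)    = [-]
from-linked a (suc (suc k)) = n≤1+n a ∷ from-linked (suc a) (suc k)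

length-from : ∀ a k → length (from a k) ≡ k
length-from a zero    = refl
length-from a (suc k) = cong suc (length-from (suc a) k)

-- This is abstract so that pattern matching on the equation does not unfold its proof.
abstract
  sorted-unique : Linked _≤_ v → Linked _≤_ w → v ↭ w → v ≡ w
  sorted-unique v↗ w↗ p = ≋⇒≡ (↗↭↗⇒≋ ≤-totalOrder v↗ w↗ (↭⇒↭ₛ p))

-- Representatives of the classes

-- Indices of the classes of permutations of 1 … n, for n ≥ 1: inc is the identity, up puts n
-- in front of a permutation of 1 … n - 1, dip k moves the letter k + 1 ≤ n - 2 of the
-- identity to its end (k counts from 0), and pair is 2 1 3 … n with n ≥ 4. For n = 3 the
-- word 2 1 3 is equivalent to 3 2 1, which is already covered by up.
data Code : ℕ → Set where
  inc  : Code (suc n)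
  up   : Code (suc n) → Code (suc (suc n))
  dip  : Fin m → Code (2 + m)
  pair : Code (4 + m)

-- The word a, a + 1, …, a + m + 1 with the letter a + k moved to the end.
dipWord : ℕ → Fin m → List ℕ
dipWord {suc m} a zero    = from (suc a) (2 + m) ++ [ a ]
dipWord {suc m} a (suc k) = a ∷ dipWord (suc a) k

-- The representative of each class.
rep : Code n → List ℕ
rep (inc {n})  = from 1 (suc n)
rep (up {n} i) = suc (suc n) ∷ rep i
rep (dip k)    = dipWord 1 k
rep (pair {m}) = 2 ∷ 1 ∷ from 3 (2 + m)

dipWord-↭ : ∀ a (k : Fin m) → dipWord a k ↭ from a (2 + m)
dipWord-↭ {suc m} a zero    = ++-comm (from (suc a) (2 + m)) [ a ]
dipWord-↭ {suc m} a (suc k) = prep a (dipWord-↭ (suc a) k)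

rep-↭ : (i : Code n) → rep i ↭ from 1 n
rep-↭ inc        = ↭-refl
rep-↭ (up {n} i) = ↭-trans (prep _ (rep-↭ i)) (↭-sym (from-last 1 (suc n)))
rep-↭ (dip k)    = dipWord-↭ 1 k
rep-↭ pair       = ↭.swap 2 1 ↭-refl

-- Every permutation is equivalent to a representative

Run⇒Linked : Run M [] u s → Linked _≤_ (u ∷ s)
Run⇒Linked (end u≤M)    = u≤M ∷ [-]
Run⇒Linked (step u≤t r) = u≤t ∷ Run⇒Linked r

-- A dip without its last letter is sorted and has at least two letters.
Dip-split : Dip M z u s → ∃[ y ] ∃[ v ] s ≡ (y ∷ v) ++ [ z ] × Linked _≤_ (u ∷ y ∷ v)
Dip-split (end {u} z≤u u≤M) = _ , [] , refl , u≤M ∷ [-]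
Dip-split (step {t = t} u≤t d) with y , v , refl , lk ← Dip-split d = t , y ∷ v , refl , u≤t ∷ lk

Dip-lower : Dip M z u s → x ≤ u → x ≤ z → All (x ≤_) (u ∷ s)
Dip-lower (end z≤u u≤M) x≤u x≤z = x≤u ∷ ≤-trans x≤u u≤M ∷ x≤z ∷ []
Dip-lower (step u≤t d) x≤u x≤z = x≤u ∷ Dip-lower d (≤-trans x≤u u≤t) x≤z

minimum-first : All (u ≤_) s → u ∷ s ↭ from a (suc k) → u ≡ a
minimum-first {a = a} {k = k} lo p =
  ≤-antisym (All.lookup (≤-refl ∷ lo) (∈-resp-↭ (↭-sym p) (here refl)))
            (All.lookup (from-≥ a (suc k)) (∈-resp-↭ p (here refl)))

-- If the last letter z is at most the first letter u, then z followed by the rest is sorted,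
-- hence equal to the interval; so z is its least element.
dip-bottom-first : Linked _≤_ (u ∷ y ∷ v) → z ≤ u → (u ∷ y ∷ v) ++ [ z ] ↭ from a (2 + m) →
                   Σ[ k ∈ Fin m ] (u ∷ y ∷ v) ++ [ z ] ≡ dipWord a k
dip-bottom-first {u} {y} {v} {z} {a} {m} lk z≤u p
  with sorted-unique (z≤u ∷ lk) (from-linked a (2 + m)) (↭-trans (++-comm [ z ] (u ∷ y ∷ v)) p)
dip-bottom-first {m = suc m} _ _ _ | refl = zero , refl

-- A dip that is a permutation of an interval is one of the words dipWord: as long as the
-- first letter is at most z, it is the least element of the interval and can be removed.
Dip⇒dipWord : Dip M z u s → u ∷ s ↭ from a (2 + m) → Σ[ k ∈ Fin m ] u ∷ s ≡ dipWord a k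
Dip⇒dipWord d@(end z≤u u≤M) p = dip-bottom-first (u≤M ∷ [-]) z≤u p
Dip⇒dipWord {z = z} {u = u} d@(step u≤t d′) p with ≤-total z u
... | inj₁ z≤u with y , v , refl , lk ← Dip-split d = dip-bottom-first lk z≤u p
Dip⇒dipWord {z = z} {u = u} d@(step u≤t d′) p | inj₂ u≤z
  with refl ← minimum-first (Dip-lower d′ u≤t u≤z) p = tail d′ (drop-∷ p)
  where
  tail : Dip M z t s → t ∷ s ↭ from (suc u) (suc m) → Σ[ k ∈ Fin m ] u ∷ t ∷ s ≡ dipWord u k
  tail {m = zero} d q with _ , _ , refl , _ ← Dip-split d with () ← ↭-length q
  tail {m = suc m} d q with k , eq ← Dip⇒dipWord d q = suc k , cong (u ∷_) eq

-- Every permutation of 1 … n + 1 is equivalent to a representative, by recursion on n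
-- when it is equivalent to a word that starts with n + 1.
classify-shape : ∀ n → Shape (suc n) v → v ↭ from 1 (suc n) → Σ[ i ∈ Code (suc n) ] v ≈ rep i
classify : ∀ n → w ↭ from 1 (suc n) → Σ[ i ∈ Code (suc n) ] w ≈ rep i

classify n p
  with v , w≈v , sh ← hasShape (∈-resp-↭ (↭-sym (↭-trans p (from-last 1 n))) (here refl))
                               (All.map s≤s⁻¹ (All-resp-↭ (↭-sym p) (from-< 1 (suc n))))
  with i , v≈i ← classify-shape n sh (↭-trans (↭-sym (≈⇒↭ w≈v)) p)
  = i , ≈-trans w≈v v≈i

classify-shape n top p with drop-∷ (↭-trans p (from-last 1 n))
classify-shape zero top p | q with refl ← ↭-empty-inv q = inc , ≈-refl
classify-shape (suc n) top p | q with i , w≈i ← classify n q = up i , (suc (suc n) ◂ w≈i)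
classify-shape n (inc r) p = inc , reflexive (sorted-unique (Run⇒Linked r) (from-linked 1 (suc n)) p)
classify-shape zero (dip d) p with _ , _ , refl , _ ← Dip-split d with () ← ↭-length p
classify-shape (suc n) (dip d) p with k , eq ← Dip⇒dipWord d p = dip k , reflexive eq
classify-shape n (pair {a} {b} a≤b b≤t r) p = canonical n r
  (sorted-unique (a≤b ∷ b≤t ∷ Run⇒Linked r) (from-linked 1 (suc n)) (↭-trans (↭.swap a b ↭-refl) p))
  where
  canonical : ∀ n → Run M [] t s → a ∷ b ∷ t ∷ s ≡ from 1 (suc n) → Σ[ i ∈ Code (suc n) ] b ∷ a ∷ t ∷ s ≈ rep i
  canonical (suc (suc zero)) (end _) ()
  canonical (suc (suc zero)) (step _ _) ()
  canonical (suc (suc (suc n))) _ refl = pair , ≈-refl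

-- Representatives are pairwise inequivalent

-- A word is rigid if every three consecutive letters x y z satisfy x < y < z or z < x < y,
-- that is, have order permutation 123 or 231. No move applies to such a word.
data Rigid : List ℕ → Set where
  []    : Rigid []
  [-]   : Rigid (x ∷ [])
  [-,-] : Rigid (x ∷ y ∷ [])
  cons  : x < y → y < z ⊎ z < x → Rigid (y ∷ z ∷ w) → Rigid (x ∷ y ∷ z ∷ w)

no-step-from : Rigid v → ¬ Step v w
no-step-from (cons x<z (inj₁ z<y) _) (swap x≤y y≤z) = <⇒≱ z<y y≤z
no-step-from (cons x<z (inj₂ y<x) _) (swap x≤y y≤z) = <⇒≱ y<x x≤y
no-step-from (cons z<y _ _) (turn x≤y y≤z) = <⇒≱ z<y y≤z
no-step-from (cons _ _ r) (skip st) = no-step-from r st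
no-step-from [-] (skip ())
no-step-from [-,-] (skip (skip ()))

no-step-to : Rigid w → ¬ Step v w
no-step-to (cons z<x _ _) (swap x≤y y≤z) = <⇒≱ z<x (≤-trans x≤y y≤z)
no-step-to (cons y<x _ _) (turn x≤y y≤z) = <⇒≱ y<x x≤y
no-step-to (cons _ _ r) (skip st) = no-step-to r st
no-step-to [-] (skip ())
no-step-to [-,-] (skip (skip ()))

rigid-class : Rigid v → v ≈ w → v ≡ w
rigid-class r ε              = refl
rigid-class r (fwd st ◅ _) = contradiction st (no-step-from r)
rigid-class r (bwd st ◅ _) = contradiction st (no-step-to r)

from-rigid : ∀ a k → Rigid (from a k)
from-rigid a zero = []
from-rigid a (suc zero) = [-]
from-rigid a (suc (suc zero)) = [-,-]
from-rigid a (suc (suc (suc k))) = cons ≤-refl (inj₁ ≤-refl) (from-rigid (suc a) (suc (suc k)))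

from-then-rigid : ∀ k → x < a → Rigid (from a (suc k) ++ [ x ])
from-then-rigid zero x<a = [-,-]
from-then-rigid (suc zero) x<a = cons ≤-refl (inj₂ x<a) [-,-]
from-then-rigid (suc (suc k)) x<a = cons ≤-refl (inj₁ ≤-refl) (from-then-rigid (suc k) (m≤n⇒m≤1+n x<a))

dipWord-rigid : ∀ a (k : Fin m) → Rigid (dipWord a k)
dipWord-rigid {suc m} a zero = from-then-rigid (suc m) ≤-refl
dipWord-rigid {suc (suc m)} a (suc zero) = cons (m≤n⇒m≤1+n ≤-refl) (inj₁ ≤-refl) (dipWord-rigid (suc a) zero)
dipWord-rigid {suc (suc (suc m))} a (suc (suc zero)) = cons ≤-refl (inj₁ (m≤n⇒m≤1+n ≤-refl)) (dipWord-rigid (suc a) (suc zero))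
dipWord-rigid {suc (suc (suc m))} a (suc (suc (suc k))) = cons ≤-refl (inj₁ ≤-refl) (dipWord-rigid (suc a) (suc (suc k)))

-- Climb x s says that x s is strictly increasing.
data Climb : ℕ → List ℕ → Set where
  []  : Climb x []
  _∷_ : x < t → Climb t s → Climb x (t ∷ s)

climb-rigid : Climb x s → Rigid s
climb-rigid [] = []
climb-rigid (_ ∷ []) = [-]
climb-rigid (_ ∷ _ ∷ []) = [-,-]
climb-rigid (_ ∷ c@(x<y ∷ (y<z ∷ _))) = cons x<y (inj₁ y<z) (climb-rigid c)

-- PairIn a b x v says that v is b a inserted, as two consecutive letters, into a sequence
-- that is strictly increasing and stays above x. When a < b ≤ x this property is invariant
-- under moves: the only moves available turn b a t into t b a and back.
data PairIn (a b : ℕ) : ℕ → List ℕ → Set where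
  here  : Climb x s → PairIn a b x (b ∷ a ∷ s)
  there : x < t → PairIn a b t s → PairIn a b x (t ∷ s)

pair-step-from : a < b → b ≤ x → PairIn a b x v → Step v w → PairIn a b x w
pair-step-from a<b b≤x (here _) (swap b≤y y≤a) = contradiction (≤-trans b≤y y≤a) (<⇒≱ a<b)
pair-step-from a<b b≤x (here (x<t ∷ _)) (turn t≤a _) =
  contradiction (≤-trans t≤a (≤-trans (<⇒≤ a<b) b≤x)) (<⇒≱ x<t)
pair-step-from a<b b≤x (here (_ ∷ (t<y ∷ _))) (skip (swap _ y≤t)) = contradiction y≤t (<⇒≱ t<y)
pair-step-from a<b b≤x (here (x<t ∷ _)) (skip (turn _ t≤a)) =
  contradiction (≤-trans t≤a (≤-trans (<⇒≤ a<b) b≤x)) (<⇒≱ x<t)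
pair-step-from a<b b≤x (here c) (skip (skip st)) = contradiction st (no-step-from (climb-rigid c))
pair-step-from a<b b≤x (there x<t (here _)) (swap t≤y y≤b) =
  contradiction (≤-trans t≤y (≤-trans y≤b b≤x)) (<⇒≱ x<t)
pair-step-from a<b b≤x (there x<t (there t<z (here _))) (swap t≤b _) =
  contradiction (≤-trans t≤b b≤x) (<⇒≱ x<t)
pair-step-from a<b b≤x (there x<t (there t<z (there z<y _))) (swap _ y≤z) = contradiction y≤z (<⇒≱ z<y)
pair-step-from a<b b≤x (there x<t (here c)) (turn _ _) = here (x<t ∷ c)
pair-step-from a<b b≤x (there x<t (there t<y _)) (turn _ y≤t) = contradiction y≤t (<⇒≱ t<y)
pair-step-from a<b b≤x (there x<t p) (skip st) =
  there x<t (pair-step-from a<b (≤-trans b≤x (<⇒≤ x<t)) p st)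

pair-step-to : a < b → b ≤ x → PairIn a b x w → Step v w → PairIn a b x v
pair-step-to a<b b≤x (here (x<y ∷ _)) (swap _ y≤b) = contradiction (≤-trans y≤b b≤x) (<⇒≱ x<y)
pair-step-to a<b b≤x (here (x<t ∷ c)) (turn _ _) = there x<t (here c)
pair-step-to a<b b≤x (here (x<t ∷ _)) (skip (swap t≤y y≤a)) =
  contradiction (≤-trans (≤-trans t≤y y≤a) (≤-trans (<⇒≤ a<b) b≤x)) (<⇒≱ x<t)
pair-step-to a<b b≤x (here (x<t ∷ _)) (skip (turn t≤a _)) =
  contradiction (≤-trans t≤a (≤-trans (<⇒≤ a<b) b≤x)) (<⇒≱ x<t)
pair-step-to a<b b≤x (here c) (skip (skip st)) = contradiction st (no-step-to (climb-rigid c))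
pair-step-to a<b b≤x (there x<t (here _)) (swap b≤a _) = contradiction b≤a (<⇒≱ a<b)
pair-step-to a<b b≤x (there x<t (there t<x′ _)) (swap x′≤y y≤t) =
  contradiction (≤-trans x′≤y y≤t) (<⇒≱ t<x′)
pair-step-to a<b b≤x (there x<t (here _)) (turn _ t≤a) =
  contradiction (≤-trans t≤a (≤-trans (<⇒≤ a<b) b≤x)) (<⇒≱ x<t)
pair-step-to a<b b≤x (there x<t (there t<x′ _)) (turn x′≤t _) = contradiction x′≤t (<⇒≱ t<x′)
pair-step-to a<b b≤x (there x<t p) (skip st) =
  there x<t (pair-step-to a<b (≤-trans b≤x (<⇒≤ x<t)) p st)

pair-class : a < b → b ≤ x → PairIn a b x v → v ≈ w → PairIn a b x w
pair-class a<b b≤x p ε            = p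
pair-class a<b b≤x p (fwd st ◅ q) = pair-class a<b b≤x (pair-step-from a<b b≤x p st) q
pair-class a<b b≤x p (bwd st ◅ q) = pair-class a<b b≤x (pair-step-to a<b b≤x p st) q

-- Deletion of all letters that are at least M. It respects moves, by below-step.
below : ℕ → List ℕ → List ℕ
below M = filter (_<? M)

accept : x < M → below M (x ∷ w) ≡ x ∷ below M w
accept {M = M} = filter-accept (_<? M)

reject : x ≮ M → below M (x ∷ w) ≡ below M w
reject {M = M} = filter-reject (_<? M)

below-∷ : ∀ M t → below M v ≈ below M w → below M (t ∷ v) ≈ below M (t ∷ w)
below-∷ M t p with t <? M
... | yes t<M = subst₂ _≈_ (sym (accept t<M)) (sym (accept t<M)) (t ◂ p)
... | no  t≮M = subst₂ _≈_ (sym (reject t≮M)) (sym (reject t≮M)) p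

accept₃ : x < M → y < M → z < M → below M (x ∷ y ∷ z ∷ w) ≡ x ∷ y ∷ z ∷ below M w
accept₃ {x} {y = y} p q r =
  trans (accept p) (cong (x ∷_) (trans (accept q) (cong (y ∷_) (accept r))))

below-step : ∀ M → Step v w → below M v ≈ below M w
below-step M (swap {x} {y} {z} {w} x≤y y≤z) with z <? M
... | yes z<M = subst₂ _≈_ (sym (accept₃ x<M z<M y<M)) (sym (accept₃ z<M x<M y<M)) (swap≈ x≤y y≤z)
  where
  y<M : y < M
  y<M = ≤-<-trans y≤z z<M
  x<M : x < M
  x<M = ≤-<-trans x≤y y<M
... | no z≮M = ≈-trans (below-∷ M x (reflexive (reject z≮M))) (reflexive (sym (reject z≮M)))
below-step M (turn {x} {y} {z} {w} x≤y y≤z) with z <? M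
... | yes z<M = subst₂ _≈_ (sym (accept₃ z<M y<M x<M)) (sym (accept₃ y<M x<M z<M)) (turn≈ x≤y y≤z)
  where
  y<M : y < M
  y<M = ≤-<-trans y≤z z<M
  x<M : x < M
  x<M = ≤-<-trans x≤y y<M
... | no z≮M = ≈-trans (reflexive (reject z≮M))
                 (below-∷ M y (below-∷ M x (reflexive (sym (reject z≮M)))))
below-step M (skip {t = t} st) = below-∷ M t (below-step M st)

-- A new largest letter in front can be cancelled from an equivalence.
∷-cancel-≈ : All (_< M) v → All (_< M) w → M ∷ v ≈ M ∷ w → v ≈ w
∷-cancel-≈ {M} v<M w<M p = subst₂ _≈_ (restrict v<M) (restrict w<M)
  (gfold (Setoid.isEquivalence words) (below M) (below-step M) p)
  where
  restrict : ∀ {v} → All (_< M) v → below M (M ∷ v) ≡ v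
  restrict {v} v<M = trans (reject {w = v} (<-irrefl refl)) (filter-all (_<? M) v<M)

from≢dipWord : ∀ a (k : Fin m) → from a (2 + m) ≢ dipWord a k
from≢dipWord {suc m} a zero    ()
from≢dipWord {suc m} a (suc k) eq = from≢dipWord (suc a) k (∷-injectiveʳ eq)

dipWord-injective : ∀ a (j k : Fin m) → dipWord a j ≡ dipWord a k → j ≡ k
dipWord-injective {suc m} a zero    zero    _  = refl
dipWord-injective {suc m} a (suc j) (suc k) eq = cong suc (dipWord-injective (suc a) j k (∷-injectiveʳ eq))
dipWord-injective {suc m} a zero    (suc k) ()
dipWord-injective {suc m} a (suc j) zero    ()

inc-injective : (j : Code (suc n)) → from 1 (suc n) ≡ rep j → inc ≡ j
inc-injective inc     _  = refl
inc-injective (dip k) eq = contradiction eq (from≢dipWord 1 k)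

dip-injective : (k : Fin m) (j : Code (2 + m)) → dipWord 1 k ≡ rep j → dip k ≡ j
dip-injective k inc eq = contradiction (sym eq) (from≢dipWord 1 k)
dip-injective k (dip j) eq = cong dip (dipWord-injective 1 k j eq)
dip-injective {suc m} zero (up j) ()
dip-injective {suc m} (suc k) (up j) ()
dip-injective zero pair ()
dip-injective (suc k) pair ()

rep-< : (i : Code n) → All (_< suc n) (rep i)
rep-< {n} i = All-resp-↭ (↭-sym (rep-↭ i)) (from-< 1 n)

climb-from : x < a → ∀ k → Climb x (from a k)
climb-from x<a zero    = []
climb-from x<a (suc k) = x<a ∷ climb-from ≤-refl k

-- If v has at least three letters, all below M, then it is not b a inserted into an increasing
-- sequence above M, since the third letter would have to exceed M.
no-pair-above : 3 ≤ length v → All (_< M) v → ¬ PairIn a b M v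
no-pair-above (s≤s (s≤s ())) _ (here [])
no-pair-above _ (_ ∷ _ ∷ t<M ∷ _) (here (M<t ∷ _)) = <-asym t<M M<t
no-pair-above _ (t<M ∷ _) (there M<t _) = <-asym t<M M<t

-- The class of 2 1 3 … n consists of words PairIn 1 2 2, and none of these starts with n.
pair≉up : (i : Code (3 + m)) → ¬ rep (pair {m}) ≈ rep (up i)
pair≉up {m} i p with pair-class ≤-refl ≤-refl (here (climb-from ≤-refl (2 + m))) p
... | there _ q = no-pair-above (subst (3 ≤_) (sym (trans (↭-length (rep-↭ i)) (length-from 1 (3 + m)))) 3≤3+) (rep-< i) q

rep-injective : (i j : Code n) → rep i ≈ rep j → i ≡ j
rep-injective {suc n} inc j p = inc-injective j (rigid-class (from-rigid 1 (suc n)) p)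
rep-injective (dip k) j p = dip-injective k j (rigid-class (dipWord-rigid 1 k) p)
rep-injective {suc n} i inc p = sym (inc-injective i (rigid-class (from-rigid 1 (suc n)) (≈-sym p)))
rep-injective i (dip k) p = sym (dip-injective k i (rigid-class (dipWord-rigid 1 k) (≈-sym p)))
rep-injective (up i) (up j) p = cong up (rep-injective i j (∷-cancel-≈ (rep-< i) (rep-< j) p))
rep-injective pair pair _ = refl
rep-injective pair (up j) p = contradiction p (pair≉up j)
rep-injective (up i) pair p = contradiction (≈-sym p) (pair≉up i)

-- Permutations as lists of letters

Unique-resp-↭ : v ↭ w → Unique v → Unique w
Unique-resp-↭ p = PermSetoid.Unique-resp-↭ (setoid ℕ) (↭⇒↭ₛ p)

from-unique : ∀ a k → Unique (from a k)
from-unique a zero    = []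
from-unique a (suc k) = All.map <⇒≢ (from-≥ (suc a) k) ∷ from-unique (suc a) k

∈-from : a ≤ x → x < a + k → x ∈ from a k
∈-from {a} {x} {k = zero} a≤x x<a rewrite +-identityʳ a = contradiction a≤x (<⇒≱ x<a)
∈-from {a} {x} {k = suc k} a≤x x<a+1+k with a ≟ x
... | yes refl = here refl
... | no a≢x = there (∈-from (≤∧≢⇒< a≤x a≢x) (subst (x <_) (+-suc a k) x<a+1+k))

-- A pigeonhole principle: distinct letters taken from a list that is not longer exhaust
-- that list.
⊆-long⇒↭ : Unique v → v ⊆ w → length w ≤ length v → v ↭ w
⊆-long⇒↭ {[]} {[]} _ _ _ = ↭-refl
⊆-long⇒↭ {x ∷ v} (x∉v ∷ v!) v⊆w |w|≤|v| with ys , zs , refl ← ∈-∃++ (v⊆w (here refl)) =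
  ↭-trans (prep x (⊆-long⇒↭ v! v⊆rest (s≤s⁻¹ (subst (_≤ _) (↭-length (shift x ys zs)) |w|≤|v|))))
          (↭-sym (shift x ys zs))
  where
  v⊆rest : v ⊆ ys ++ zs
  v⊆rest {y} y∈v with ∈-resp-↭ (shift x ys zs) (v⊆w (there y∈v))
  ... | here y≡x = contradiction (sym y≡x) (All.lookup x∉v y∈v)
  ... | there y∈ = y∈

toList-unique : {u : Vec ℕ k} → VecUnique.Unique u → Unique (toList u)
toList-unique []        = []
toList-unique (x∉ ∷ u!) = VecAll.toList⁺ x∉ ∷ toList-unique u!

toList-unique-inverse : (u : Vec ℕ k) → Unique (toList u) → VecUnique.Unique u
toList-unique-inverse []      []        = []
toList-unique-inverse (_ ∷ u) (x∉ ∷ u!) = VecAll.toList⁻ x∉ ∷ toList-unique-inverse u u!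

-- The one-line notation of a permutation, as a list.
letters : S n → List ℕ
letters φ = toList (word φ)

letters-↭ : (φ : S n) → letters φ ↭ from 1 n
letters-↭ {n} (perm u p) with bounds , unique ← recompute (isPermutation? u) p =
  ⊆-long⇒↭ (toList-unique unique)
    (λ x∈u → let 1≤x , x≤n = All.lookup (VecAll.toList⁺ bounds) x∈u in ∈-from 1≤x (s≤s x≤n))
    (≤-reflexive (trans (length-from 1 n) (sym (length-toList u))))

-- Every rearrangement of 1 … n is the word of an element of S n.
fromLetters : (v : List ℕ) → v ↭ from 1 n → Σ[ φ ∈ S n ] letters φ ≡ v
fromLetters {n} v p = perm vec (isPerm (subst (_↭ from 1 n) (sym vec≡v) p)) , vec≡v
  where
  |v|≡n : length v ≡ n
  |v|≡n = trans (↭-length p) (length-from 1 n)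
  vec : Vec ℕ n
  vec = cast |v|≡n (fromList v)
  vec≡v : toList vec ≡ v
  vec≡v = trans (toList-cast |v|≡n (fromList v)) (toList∘fromList v)
  isPerm : toList vec ↭ from 1 n → IsPermutation vec
  isPerm q = VecAll.toList⁻ (All.zipWith (λ (1≤x , x<1+n) → 1≤x , s≤s⁻¹ x<1+n)
                   (All-resp-↭ (↭-sym q) (from-≥ 1 n) , All-resp-↭ (↭-sym q) (from-< 1 n)))
           , toList-unique-inverse vec (Unique-resp-↭ (↭-sym q) (from-unique 1 n))

letters-injective : (φ ψ : S n) → letters φ ≡ letters ψ → φ ≡ ψ
letters-injective (perm u _) (perm v _) eq
  with refl ← trans (sym (cast-is-id refl u)) (toList-injective refl u v eq) = refl

-- Replacements are moves on words

++-cancelˡ-↭ : ∀ u → u ++ v ↭ u ++ w → v ↭ w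
++-cancelˡ-↭ []      p = p
++-cancelˡ-↭ (x ∷ u) p = ++-cancelˡ-↭ u (drop-∷ p)

++-cancelʳ-↭ : ∀ u → v ++ u ↭ w ++ u → v ↭ w
++-cancelʳ-↭ {v} {w} u p = ++-cancelˡ-↭ u (↭-trans (++-comm u v) (↭-trans p (++-comm w u)))

≈-++ : ∀ u → v ≈ w → u ++ v ≈ u ++ w
≈-++ []      p = p
≈-++ (x ∷ u) p = x ◂ ≈-++ u p

sorted-triple-unique : ∀ {x y z x′ y′ z′} → x ≤ y → y ≤ z → x′ ≤ y′ → y′ ≤ z′ →
  x ∷ y ∷ z ∷ [] ↭ x′ ∷ y′ ∷ z′ ∷ [] → _≡_ {A = List ℕ} (x ∷ y ∷ z ∷ []) (x′ ∷ y′ ∷ z′ ∷ [])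
sorted-triple-unique p q p′ q′ = sorted-unique (p ∷ q ∷ [-]) (p′ ∷ q′ ∷ [-])

↭132 : x ∷ y ∷ z ∷ [] ↭ x ∷ z ∷ y ∷ []
↭132 = prep _ (↭.swap _ _ ↭-refl)

↭213 : x ∷ y ∷ z ∷ [] ↭ y ∷ x ∷ z ∷ []
↭213 = ↭.swap _ _ ↭-refl

↭231 : x ∷ y ∷ z ∷ [] ↭ y ∷ z ∷ x ∷ []
↭231 = ↭-trans ↭213 ↭132

↭312 : x ∷ y ∷ z ∷ [] ↭ z ∷ x ∷ y ∷ []
↭312 = ↭-trans ↭132 ↭213

↭321 : x ∷ y ∷ z ∷ [] ↭ z ∷ y ∷ x ∷ []
↭321 = ↭-trans ↭213 ↭312

conj : ∀ {v′ w′ : List ℕ} → v ↭ v′ → w ↭ w′ → v ↭ w → v′ ↭ w′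
conj p q r = ↭-trans (↭-sym p) (↭-trans r q)

-- Two words of length three with the same letters in the same relative order are equal; the
-- cases sort the letters.
orderIso-unique : (u v : Vec ℕ 3) → (∀ i j → lookup u i ≤ lookup u j → lookup v i ≤ lookup v j) →
                  toList u ↭ toList v → toList u ≡ toList v
orderIso-unique (x ∷ y ∷ z ∷ []) (x′ ∷ y′ ∷ z′ ∷ []) f p with ≤-total x y | ≤-total y z | ≤-total x z
... | inj₁ x≤y | inj₁ y≤z | _
  with refl ← sorted-triple-unique x≤y y≤z (f 0F 1F x≤y) (f 1F 2F y≤z) p = refl
... | inj₁ x≤y | inj₂ z≤y | inj₁ x≤z
  with refl ← sorted-triple-unique x≤z z≤y (f 0F 2F x≤z) (f 2F 1F z≤y) (conj ↭132 ↭132 p) = refl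
... | inj₁ x≤y | inj₂ z≤y | inj₂ z≤x
  with refl ← sorted-triple-unique z≤x x≤y (f 2F 0F z≤x) (f 0F 1F x≤y) (conj ↭312 ↭312 p) = refl
... | inj₂ y≤x | inj₁ y≤z | inj₁ x≤z
  with refl ← sorted-triple-unique y≤x x≤z (f 1F 0F y≤x) (f 0F 2F x≤z) (conj ↭213 ↭213 p) = refl
... | inj₂ y≤x | inj₁ y≤z | inj₂ z≤x
  with refl ← sorted-triple-unique y≤z z≤x (f 1F 2F y≤z) (f 2F 0F z≤x) (conj ↭231 ↭231 p) = refl
... | inj₂ y≤x | inj₂ z≤y | _
  with refl ← sorted-triple-unique z≤y y≤x (f 2F 1F z≤y) (f 1F 0F y≤x) (conj ↭321 ↭321 p) = refl

K : ReplacementPartition 3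
K = K₁₃₂₋₃₁₂∣₃₂₁₋₂₁₃

same-order : ∀ {σ : S k} {u v} → IsOrderPermutationOf σ u → IsOrderPermutationOf σ v →
             ∀ i j → lookup u i ≤ lookup u j → lookup v i ≤ lookup v j
same-order σ-u σ-v i j uᵢ≤uⱼ = ≮⇒≥ λ vⱼ<vᵢ →
  <⇒≱ (Equivalence.to (σ-u j i) (Equivalence.from (σ-v j i) vⱼ<vᵢ)) uᵢ≤uⱼ

≤-at : (σ : S k) (u : Vec ℕ k) → IsOrderPermutationOf σ u → ∀ i j →
       lookup (word σ) i < lookup (word σ) j → lookup u i ≤ lookup u j
≤-at _ _ σ-u i j p = <⇒≤ (Equivalence.to (σ-u i j) p)

-- Two windows with order permutations 132 and 312 and the same letters differ by a move; the
-- hypotheses list the letters of each window in increasing order.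
swap-window : (u v : Vec ℕ 3) →
  lookup u 0F ≤ lookup u 2F → lookup u 2F ≤ lookup u 1F →
  lookup v 1F ≤ lookup v 2F → lookup v 2F ≤ lookup v 0F →
  toList u ↭ toList v → Step (toList u ++ w) (toList v ++ w)
swap-window (x ∷ z ∷ y ∷ []) (z′ ∷ x′ ∷ y′ ∷ []) p q p′ q′ r
  with refl ← sorted-triple-unique p q p′ q′ (conj ↭132 ↭231 r) = swap p q

-- The same for the order permutations 321 and 213.
turn-window : (u v : Vec ℕ 3) →
  lookup u 2F ≤ lookup u 1F → lookup u 1F ≤ lookup u 0F →
  lookup v 1F ≤ lookup v 0F → lookup v 0F ≤ lookup v 2F →
  toList u ↭ toList v → Step (toList u ++ w) (toList v ++ w)
turn-window (z ∷ y ∷ x ∷ []) (y′ ∷ x′ ∷ z′ ∷ []) p q p′ q′ r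
  with refl ← sorted-triple-unique p q p′ q′ (conj ↭321 ↭213 r) = turn p q

1<2 : 1 < 2
1<2 = s≤s (s≤s z≤n)

2<3 : 2 < 3
2<3 = s≤s (s≤s (s≤s z≤n))

-- A replacement keeps the set of letters of the permutation, hence of the window. With the
-- letters fixed, the window is determined by its order permutation.
window : (u v : Vec ℕ 3) (σ τ : S 3) → IsOrderPermutationOf σ u → IsOrderPermutationOf τ v →
         SamePart K σ τ → toList u ↭ toList v → toList u ++ w ≈ toList v ++ w
window {w} u v σ _ f g (inj₁ refl) p =
  reflexive (cong (_++ w) (orderIso-unique u v (same-order {σ = σ} {u} {v} f g) p))
window u v σ τ f g (inj₂ (here (here refl , here refl))) p =
  window u v σ τ f g (inj₁ refl) p
window u v σ τ f g (inj₂ (here (there (here refl) , there (here refl)))) p =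
  window u v σ τ f g (inj₁ refl) p
window u v σ τ f g (inj₂ (there (here (here refl , here refl)))) p =
  window u v σ τ f g (inj₁ refl) p
window u v σ τ f g (inj₂ (there (here (there (here refl) , there (here refl))))) p =
  window u v σ τ f g (inj₁ refl) p
window u v σ τ f g (inj₂ (here (here refl , there (here refl)))) p =
  return (swap-window u v (≤-at σ u f 0F 2F 1<2) (≤-at σ u f 2F 1F 2<3)
                          (≤-at τ v g 1F 2F 1<2) (≤-at τ v g 2F 0F 2<3) p)
window u v σ τ f g (inj₂ (here (there (here refl) , here refl))) p =
  ≈-sym (window v u τ σ g f (inj₂ (here (here refl , there (here refl)))) (↭-sym p))
window u v σ τ f g (inj₂ (there (here (here refl , there (here refl))))) p =
  return (turn-window u v (≤-at σ u f 2F 1F 1<2) (≤-at σ u f 1F 0F 2<3)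
                          (≤-at τ v g 1F 0F 1<2) (≤-at τ v g 0F 2F 2<3) p)
window u v σ τ f g (inj₂ (there (here (there (here refl) , here refl)))) p =
  ≈-sym (window v u τ σ g f (inj₂ (there (here (here refl , there (here refl))))) (↭-sym p))

replacement⇒≈ : (φ ψ : S n) → Replacement K φ ψ → letters φ ≈ letters ψ
replacement⇒≈ φ ψ (a , b , u , v , eqφ , eqψ , σ , τ , f , g , part)
  with p ← ↭-trans (letters-↭ φ) (↭-sym (letters-↭ ψ))
  rewrite eqφ | eqψ =
  ≈-++ a (window u v σ τ f g part (++-cancelʳ-↭ b (++-cancelˡ-↭ a p)))

-- Moves on words are replacements

-- The order of the letters x < y < z is that of their ranks 1, 2, 3.
increasing-order : x < y → y < z → (i j : Fin 3) →
  suc (toℕ i) < suc (toℕ j) ⇔ lookup (x ∷ y ∷ z ∷ []) i < lookup (x ∷ y ∷ z ∷ []) j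
increasing-order {x} {y} {z} x<y y<z i j = mk⇔ (λ p → to i j (s≤s⁻¹ p)) (λ p → s≤s (from′ i j p))
  where
  xyz : Vec ℕ 3
  xyz = x ∷ y ∷ z ∷ []
  to : ∀ i j → toℕ i < toℕ j → lookup xyz i < lookup xyz j
  to 0F 1F _ = x<y
  to 0F 2F _ = <-trans x<y y<z
  to 1F 2F _ = y<z
  to 1F 1F (s≤s ())
  to 2F 1F (s≤s ())
  to 2F 2F (s≤s (s≤s ()))
  from′ : ∀ i j → lookup xyz i < lookup xyz j → toℕ i < toℕ j
  from′ 0F 1F _ = s≤s z≤n
  from′ 0F 2F _ = s≤s z≤n
  from′ 1F 2F _ = s≤s (s≤s z≤n)
  from′ 0F 0F p = contradiction p (<-irrefl refl)
  from′ 1F 1F p = contradiction p (<-irrefl refl)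
  from′ 2F 2F p = contradiction p (<-irrefl refl)
  from′ 1F 0F p = contradiction p (<-asym x<y)
  from′ 2F 1F p = contradiction p (<-asym y<z)
  from′ 2F 0F p = contradiction p (<-asym (<-trans x<y y<z))

-- The order permutation of a window is read off from the ranks, counted from 0, of its
-- letters among x < y < z.
orderPermutation : x < y → y < z → (ranks : Vec (Fin 3) 3) →
  {p : True (isPermutation? (Vec.map (suc ∘ toℕ) ranks))} →
  IsOrderPermutationOf (⟪ Vec.map (suc ∘ toℕ) ranks ⟫ {p}) (Vec.map (lookup (x ∷ y ∷ z ∷ [])) ranks)
orderPermutation {x} {y} {z} x<y y<z ranks i j =
  subst₂ _⇔_ (cong₂ _<_ (sym (lookup-map i (suc ∘ toℕ) ranks)) (sym (lookup-map j (suc ∘ toℕ) ranks)))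
             (cong₂ _<_ (sym (lookup-map i letter ranks)) (sym (lookup-map j letter ranks)))
             (increasing-order x<y y<z (lookup ranks i) (lookup ranks j))
  where
  letter : Fin 3 → ℕ
  letter = lookup (x ∷ y ∷ z ∷ [])

-- The relation of Replacement K, stated for lists of letters rather than for elements of
-- S n.
ReplacedWindow : List ℕ → List ℕ → Set
ReplacedWindow v w = ∃[ a ] ∃[ b ] ∃[ s ] ∃[ t ]
  v ≡ a ++ toList {n = 3} s ++ b × w ≡ a ++ toList {n = 3} t ++ b ×
  (∃[ σ ] ∃[ τ ] IsOrderPermutationOf σ s × IsOrderPermutationOf τ t × SamePart K σ τ)

step⇒replacedWindow : Unique v → Step v w → ReplacedWindow v w
step⇒replacedWindow ((_ ∷ x≢y ∷ _) ∷ (z≢y ∷ _) ∷ _) (swap {x} {y} {z} {w} x≤y y≤z) =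
  [] , w , x ∷ z ∷ y ∷ [] , z ∷ x ∷ y ∷ [] , refl , refl , _ , _ ,
  orderPermutation x<y y<z (0F ∷ 2F ∷ 1F ∷ []) ,
  orderPermutation x<y y<z (2F ∷ 0F ∷ 1F ∷ []) ,
  inj₂ (here (here refl , there (here refl)))
  where
  x<y : x < y
  x<y = ≤∧≢⇒< x≤y x≢y
  y<z : y < z
  y<z = ≤∧≢⇒< y≤z (≢-sym z≢y)
step⇒replacedWindow ((z≢y ∷ _) ∷ (y≢x ∷ _) ∷ _) (turn {x} {y} {z} {w} x≤y y≤z) =
  [] , w , z ∷ y ∷ x ∷ [] , y ∷ x ∷ z ∷ [] , refl , refl , _ , _ ,
  orderPermutation x<y y<z (2F ∷ 1F ∷ 0F ∷ []) ,
  orderPermutation x<y y<z (1F ∷ 0F ∷ 2F ∷ []) ,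
  inj₂ (there (here (here refl , there (here refl))))
  where
  x<y : x < y
  x<y = ≤∧≢⇒< x≤y (≢-sym y≢x)
  y<z : y < z
  y<z = ≤∧≢⇒< y≤z (≢-sym z≢y)
step⇒replacedWindow (_ ∷ v!) (skip {t = t} st)
  with a , b , s , s′ , refl , refl , r ← step⇒replacedWindow v! st =
  t ∷ a , b , s , s′ , refl , refl , r

module _ {n : ℕ} where
  open Setoid (KEquivalence K n) public using () renaming (_≈_ to _∼_; reflexive to ∼-reflexive; sym to ∼-sym; trans to ∼-trans)

∼⇒≈ : {φ ψ : S n} → φ ∼ ψ → letters φ ≈ letters ψ
∼⇒≈ = gfold (Setoid.isEquivalence words) letters (λ {φ} {ψ} → replacement⇒≈ φ ψ)

step⇒∼ : (φ ψ : S n) → Step (letters φ) (letters ψ) → φ ∼ ψ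
step⇒∼ {n} φ ψ st = return (step⇒replacedWindow (Unique-resp-↭ (↭-sym (letters-↭ φ)) (from-unique 1 n)) st)

-- The moves lead from permutations to permutations, so a chain of moves between the words of
-- two permutations can be lifted to S n one move at a time.
≈⇒∼′ : (φ ψ : S n) → v ≈ w → letters φ ≡ v → letters ψ ≡ w → φ ∼ ψ
≈⇒∼′ φ ψ ε refl eq = ∼-reflexive (letters-injective φ ψ (sym eq))
≈⇒∼′ φ ψ (fwd st ◅ p) refl eq
  with χ , refl ← fromLetters _ (↭-trans (↭-sym (step-↭ st)) (letters-↭ φ)) =
  ∼-trans (step⇒∼ φ χ st) (≈⇒∼′ χ ψ p refl eq)
≈⇒∼′ φ ψ (bwd st ◅ p) refl eq
  with χ , refl ← fromLetters _ (↭-trans (step-↭ st) (letters-↭ φ)) =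
  ∼-trans (∼-sym (step⇒∼ χ φ st)) (≈⇒∼′ χ ψ p refl eq)

≈⇒∼ : (φ ψ : S n) → letters φ ≈ letters ψ → φ ∼ ψ
≈⇒∼ φ ψ p = ≈⇒∼′ φ ψ p refl refl

-- Counting the representatives

-- The number of classes for n = 3 + m.
count : ℕ → ℕ
count zero    = 4
count (suc m) = (4 + m) + count m

Code3↔Fin4 : Code 3 ↔ Fin 4
Code3↔Fin4 = mk↔ₛ′ to from′ to-from from-to
  where
  to : Code 3 → Fin 4
  to inc           = 0F
  to (dip 0F)      = 1F
  to (up inc)      = 2F
  to (up (up inc)) = 3F
  from′ : Fin 4 → Code 3
  from′ 0F = inc
  from′ 1F = dip 0F
  from′ 2F = up inc
  from′ 3F = up (up inc)
  to-from : ∀ i → to (from′ i) ≡ i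
  to-from 0F = refl
  to-from 1F = refl
  to-from 2F = refl
  to-from 3F = refl
  from-to : ∀ i → from′ (to i) ≡ i
  from-to inc           = refl
  from-to (dip 0F)      = refl
  from-to (up inc)      = refl
  from-to (up (up inc)) = refl

-- For n ≥ 4 there are n codes other than those of the form up i: inc, pair, and n - 2 codes
-- dip k.
Code-suc↔ : Code (4 + m) ↔ (Fin (4 + m) ⊎ Code (3 + m))
Code-suc↔ {m} = mk↔ₛ′ to from′ to-from from-to
  where
  to : Code (4 + m) → Fin (4 + m) ⊎ Code (3 + m)
  to inc     = inj₁ 0F
  to pair    = inj₁ 1F
  to (dip k) = inj₁ (suc (suc k))
  to (up i)  = inj₂ i
  from′ : Fin (4 + m) ⊎ Code (3 + m) → Code (4 + m)
  from′ (inj₁ 0F)            = inc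
  from′ (inj₁ 1F)            = pair
  from′ (inj₁ (suc (suc k))) = dip k
  from′ (inj₂ i)             = up i
  to-from : ∀ i → to (from′ i) ≡ i
  to-from (inj₁ 0F)            = refl
  to-from (inj₁ 1F)            = refl
  to-from (inj₁ (suc (suc k))) = refl
  to-from (inj₂ i)             = refl
  from-to : ∀ i → from′ (to i) ≡ i
  from-to inc     = refl
  from-to pair    = refl
  from-to (dip k) = refl
  from-to (up i)  = refl

Code↔Fin : ∀ m → Code (3 + m) ↔ Fin (count m)
Code↔Fin zero    = Code3↔Fin4
Code↔Fin (suc m) = ↔-sym +↔⊎ ↔-∘ ((↔-id _ ⊎-↔ Code↔Fin m) ↔-∘ Code-suc↔)

count-double : ∀ m → (count m + 2) * 2 ≡ (3 + m) * ((3 + m) + 1)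
count-double zero    = refl
count-double (suc m) = trans (expand m (count m)) (trans (cong ((4 + m) * 2 +_) (count-double m)) (collect m))
  where
  expand : ∀ m c → ((4 + m) + c + 2) * 2 ≡ (4 + m) * 2 + (c + 2) * 2
  expand = solve-∀
  collect : ∀ m → (4 + m) * 2 + (3 + m) * ((3 + m) + 1) ≡ (4 + m) * ((4 + m) + 1)
  collect = solve-∀

count-formula : ∀ m → count m ≡ (3 + m) * ((3 + m) + 1) / 2 ∸ 2
count-formula m = sym (trans
  (cong (λ k → k / 2 ∸ 2) (sym (count-double m)))
  (trans (cong (_∸ 2) (m*n/n≡m (count m + 2) 2)) (m+n∸n≡m (count m) 2)))

-- The bijection

codeOf : (φ : S (suc n)) → Code (suc n)
codeOf {n} φ = proj₁ (classify n (letters-↭ φ))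

≈-codeOf : (φ : S (suc n)) → letters φ ≈ rep (codeOf φ)
≈-codeOf {n} φ = proj₂ (classify n (letters-↭ φ))

classBijection : Bijection (KEquivalence K (suc n)) (setoid (Code (suc n)))
classBijection = record
  { to        = codeOf
  ; cong      = resp _ _
  ; bijective = (λ {φ} {ψ} eq → ≈⇒∼ φ ψ (≈-trans (≈-codeOf φ)
                    (≈-trans (reflexive (cong rep eq)) (≈-sym (≈-codeOf ψ)))))
              , λ i → let φ , eq = fromLetters (rep i) (rep-↭ i) in
                  φ , λ {ψ} ψ∼φ → rep-injective _ _
                    (≈-trans (≈-sym (≈-codeOf ψ)) (≈-trans (∼⇒≈ ψ∼φ) (reflexive eq)))
  }
  where
  resp : (φ ψ : S _) → φ ∼ ψ → codeOf φ ≡ codeOf ψ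
  resp φ ψ p = rep-injective _ _ (≈-trans (≈-sym (≈-codeOf φ)) (≈-trans (∼⇒≈ p) (≈-codeOf ψ)))

proposition3p17 : (n : ℕ) → 3 ≤ n →
    Bijection (KEquivalence K₁₃₂₋₃₁₂∣₃₂₁₋₂₁₃ n) (setoid (Fin (n * (n + 1) / 2 ∸ 2)))
proposition3p17 (suc (suc (suc m))) (s≤s (s≤s (s≤s z≤n))) =
  subst (λ k → Bijection (KEquivalence K (3 + m)) (setoid (Fin k))) (count-formula m)
    (bijection classBijection (Inverse⇒Bijection (Code↔Fin m)))
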